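{- Let $P$ be an extended logic program. Then $WFM_p(P) = A(P)$, i.e. the paraconsistent well-founded model of $P$ equals the set of literals $A(P)$ that are consequences of the argumentation semantics of $u/a$-justified arguments.
   Context: Extended logic programs. An objective literal is an atom $B$ or its explicit negation $\neg B$; $\neg\neg L = L$. A default literal is $not~L$ with $L$ an objective literal. An extended logic program $P$ is a (possibly infinite) set of (ground) rules $L_0 \gets L_1,\dots,L_m, not~L_{m+1},\dots,not~L_{m+n}$ with $m,n\ge 0$ and all $L_i$ objective literals; $L_0$ is the head, the right-hand side is the body. $\mathcal{H}(P)$ is the set of all objective literals of $P$ (Herbrand base). For a set $F$ of objective literals, $not~F = \{not~L \mid L\in F\}$. Arguments. An argument for $P$ is a finite sequence $A=[r_1,\dots,r_n]$ of rules of $P$ such that for every $i$ and every objective literal $L$ in the body of $r_i$ there is $k>i$ with $head(r_k)=L$. A subargument of $A$ is a subsequence of $A$ that is an argument. $conc(A)$ is the set of heads of rules of $A$ (conclusions); $assm(A)$ is the set of default literals in bodies of rules of $A$ (assumptions). $A$ is minimal for $L\in conc(A)$ if no proper subargument of $A$ has conclusion $L$; $A$ is minimal if it is minimal for some $L$. $\mathit{Args}_P$ is the set of minimal arguments for $P$; all arguments below range over $\mathit{Args}_P$. An argument for $L$ is an argument with conclusion $L$. Attacks. $A_1$ undercuts $A_2$ ($u$) if there is an objective literal $L\in conc(A_1)$ with $not~L\in assm(A_2)$. $A_1$ rebuts $A_2$ if there is $L\in conc(A_1)$ with $\neg L\in conc(A_2)$. $A_1$ attacks $A_2$ ($a$)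 if it undercuts or rebuts $A_2$. Justified arguments. For a set $S$ of arguments, $A$ is $u/a$-acceptable wrt. $S$ if for every argument $B$ that undercuts $A$ there is $C\in S$ that attacks $B$. $J_{u/a}$ is the least fixpoint of the monotone operator $S\mapsto\{A \mid A \text{ is } u/a\text{ -acceptable wrt. } S\}$ on subsets of $\mathit{Args}_P$. An argument is justified if it is in $J_{u/a}$, and overruled if it is attacked by a justified argument. Define $A(P) = T\cup not~F$ where $T=\{L\in\mathcal{H}(P) \mid \text{there is a justified argument for } L\}$ and $F=\{L\in\mathcal{H}(P)\mid \text{all arguments for } L \text{ are overruled}\}$. Well-founded semantics. For a set $I$ of objective literals, $\Gamma_P I$ is defined as follows: treat each $\neg B$ as a new atom, delete from $P$ all rules whose body contains some $not~L$ with $L\in I$, delete all remaining default literals, and let $\Gamma_P I$ be the least model of the resulting definite program (new atoms translated back to explicit negations). The semi-normal version $P_s$ of $P$ is obtained by replacing every rule $L\gets Body$ by $L\gets not~\neg L, Body$. Write $\Gamma=\Gamma_P$, $\Gamma_s=\Gamma_{P_s}$. The operator $\Gamma\Gamma_s$ is monotone; let $T$ be its least fixpoint. The paraconsistent well-founded model is $WFM_p(P) = T\cup not~(\mathcal{H}(P)-\Gamma_s T)$. -}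

module Defs where

open import Axiom.ExcludedMiddle using (ExcludedMiddle)
open import Data.Fin using (Fin; _<_)
open import Data.List using (List; []; _∷_; _++_; map; concatMap; length; lookup)
import Data.List.Membership.Propositional as List
open import Data.List.Relation.Binary.Sublist.Propositional using () renaming (_⊆_ to Subsequence)
open import Data.List.Relation.Unary.All as All using (All; []; _∷_)
open import Data.Product using (∃; _×_; _,_; proj₁; proj₂)
open import Data.Sum using (_⊎_)
open import Level using (Level; _⊔_; suc; Lift; lift; lower)
open import Relation.Binary.PropositionalEquality using (_≡_; _≢_; refl)
open import Relation.Nullary.Decidable using (True; toWitness; fromWitness)
open import Relation.Unary using (Pred; _∈_; _∉_; _⊆_; _≐_; _∩_; _∖_)

------------------------------------------------------------------------
-- Extended logic programs

data ObjLit {ℓ} (Atom : Set ℓ) : Set ℓ where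
  +ve -ve : Atom → ObjLit Atom

data Literal {ℓ} (Atom : Set ℓ) : Set ℓ where
  obj : ObjLit Atom → Literal Atom
  not : ObjLit Atom → Literal Atom

-- The rule  L₀ ← L₁ , … , Lₘ , not Lₘ₊₁ , … , not Lₘ₊ₙ  has
-- pos = L₁ , … , Lₘ  and  neg = Lₘ₊₁ , … , Lₘ₊ₙ.
record Rule {ℓ} (Atom : Set ℓ) : Set ℓ where
  constructor rule
  field
    head : ObjLit Atom
    pos  : List (ObjLit Atom)
    neg  : List (ObjLit Atom)

Program : ∀ {ℓ} → Set ℓ → Set (suc ℓ)
Program {ℓ} Atom = Pred (Rule Atom) ℓ

module _ {ℓ} {Atom : Set ℓ} where

  open Rule

  infix 8 ∼_

  ∼_ : ObjLit Atom → ObjLit Atom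
  ∼ (+ve B) = -ve B
  ∼ (-ve B) = +ve B

  ∼-involutive : ∀ L → ∼ ∼ L ≡ L
  ∼-involutive (+ve B) = refl
  ∼-involutive (-ve B) = refl

  atom : ObjLit Atom → Atom
  atom (+ve B) = B
  atom (-ve B) = B

  literals : Rule Atom → List (ObjLit Atom)
  literals r = head r ∷ pos r ++ neg r

  -- All objective literals over the atoms of P; hence closed under ∼.
  ℋ : Program Atom → Pred (ObjLit Atom) ℓ
  ℋ P L = ∃ λ r → r ∈ P × atom L List.∈ map atom (literals r)

  _∪not_ : ∀ {i} → Pred (ObjLit Atom) i → Pred (ObjLit Atom) i → Pred (Literal Atom) i
  (T ∪not F) (obj L) = L ∈ T
  (T ∪not F) (not L) = L ∈ F

------------------------------------------------------------------------
-- Arguments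

  conc : List (Rule Atom) → List (ObjLit Atom)
  conc = map head

  assm : List (Rule Atom) → List (Literal Atom)
  assm = concatMap (λ r → map not (neg r))

  IsArgument : Program Atom → Pred (List (Rule Atom)) ℓ
  IsArgument P rs =
    All (_∈ P) rs ×
    (∀ (i : Fin (length rs)) L → L List.∈ pos (lookup rs i) →
       ∃ λ (k : Fin (length rs)) → i < k × head (lookup rs k) ≡ L)

  Subargument : Program Atom → List (Rule Atom) → List (Rule Atom) → Set ℓ
  Subargument P rs′ rs = Subsequence rs′ rs × IsArgument P rs′

  MinimalFor : Program Atom → ObjLit Atom → Pred (List (Rule Atom)) ℓ
  MinimalFor P L rs =
    L List.∈ conc rs ×
    (∀ rs′ → Subargument P rs′ rs → rs′ ≢ rs → L List.∉ conc rs′)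

  Minimal : Program Atom → Pred (List (Rule Atom)) ℓ
  Minimal P rs = ∃ λ L → MinimalFor P L rs

  Args : Program Atom → Set ℓ
  Args P = ∃ λ rs → IsArgument P rs × Minimal P rs

  module _ (P : Program Atom) where

    ArgumentFor : ObjLit Atom → Pred (Args P) ℓ
    ArgumentFor L a = L List.∈ conc (proj₁ a)

    Undercuts : Args P → Args P → Set ℓ
    Undercuts a b = ∃ λ L → L List.∈ conc (proj₁ a) × not L List.∈ assm (proj₁ b)

    Rebuts : Args P → Args P → Set ℓ
    Rebuts a b = ∃ λ L → L List.∈ conc (proj₁ a) × ∼ L List.∈ conc (proj₁ b)

    Attacks : Args P → Args P → Set ℓ
    Attacks a b = Undercuts a b ⊎ Rebuts a b

    Acceptable : ∀ {i} → Pred (Args P) i → Pred (Args P) (ℓ ⊔ i)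
    Acceptable S a = ∀ b → Undercuts b a → ∃ λ c → c ∈ S × Attacks c b

    data Justified : Pred (Args P) ℓ where
      justified : ∀ {a} → Acceptable Justified a → Justified a

    Justified-fixpoint : Acceptable Justified ≐ Justified
    Justified-fixpoint = justified , λ { (justified acc) → acc }

    Justified-least : ∀ {i} (S : Pred (Args P) i) → Acceptable S ⊆ S → Justified ⊆ S
    Justified-least S pre (justified acc) =
      pre λ b u → let c , jc , att = acc b u in c , Justified-least S pre jc , att

    Overruled : Pred (Args P) ℓ
    Overruled a = ∃ λ c → c ∈ Justified × Attacks c a

    𝒜 : Pred (Literal Atom) ℓ
    𝒜 = (ℋ P ∩ λ L → ∃ λ a → ArgumentFor L a × a ∈ Justified)
        ∪not
        (ℋ P ∩ λ L → ∀ a → ArgumentFor L a → a ∈ Overruled)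

------------------------------------------------------------------------
-- Definite programs

record DefiniteRule {ℓ} (X : Set ℓ) : Set ℓ where
  constructor definite
  field
    dhead : X
    dbody : List X

module _ {ℓ i} {X : Set ℓ} (D : Pred (DefiniteRule X) i) where

  open DefiniteRule

  IsModel : ∀ {j} → Pred X j → Set (ℓ ⊔ i ⊔ j)
  IsModel M = ∀ {d} → d ∈ D → All M (dbody d) → dhead d ∈ M

  data LeastModel : Pred X (ℓ ⊔ i) where
    derive : ∀ {d} → d ∈ D → All LeastModel (dbody d) → LeastModel (dhead d)

  LeastModel-model : IsModel LeastModel
  LeastModel-model = derive

  module _ {j} {M : Pred X j} (model : IsModel M) where mutual

    LeastModel-least : LeastModel ⊆ M
    LeastModel-least (derive d∈D ds) = model d∈D (LeastModel-least* ds)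

    private
      LeastModel-least* : ∀ {xs} → All LeastModel xs → All M xs
      LeastModel-least* []       = []
      LeastModel-least* (d ∷ ds) = LeastModel-least d ∷ LeastModel-least* ds

------------------------------------------------------------------------
-- Paraconsistent well-founded semantics

module _ {ℓ} {Atom : Set ℓ} where

  open Rule

  -- The atoms of the resulting definite program are objective literals,
  -- so B and its explicit negation are unrelated in its models.
  reduct : ∀ {i} → Program Atom → Pred (ObjLit Atom) i → Pred (DefiniteRule (ObjLit Atom)) (ℓ ⊔ i)
  reduct P I d = ∃ λ r → r ∈ P × All (_∉ I) (neg r) × d ≡ definite (head r) (pos r)

  Γ : ∀ {i} → Program Atom → Pred (ObjLit Atom) i → Pred (ObjLit Atom) (ℓ ⊔ i)
  Γ P I = LeastModel (reduct P I)

  seminormal : Rule Atom → Rule Atom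
  seminormal (rule L ps ns) = rule L ps (∼ L ∷ ns)

  _ˢ : Program Atom → Program Atom
  (P ˢ) r′ = ∃ λ r → r ∈ P × r′ ≡ seminormal r

  ΓΓₛ : ∀ {i} → Program Atom → Pred (ObjLit Atom) i → Pred (ObjLit Atom) (ℓ ⊔ i)
  ΓΓₛ P I = Γ P (Γ (P ˢ) I)

  -- The least fixpoint of ΓΓₛ P, as the intersection of its pre-fixpoints.
  -- (ΓΓₛ P is monotone but not strictly positive, so it does not define an
  -- inductive family.)  See T∞-fixpoint and T∞-least.
  T∞ : Program Atom → Pred (ObjLit Atom) (suc ℓ)
  T∞ P L = ∀ (S : Pred (ObjLit Atom) ℓ) → ΓΓₛ P S ⊆ S → L ∈ S

  WFMₚ : Program Atom → Pred (Literal Atom) (suc ℓ)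
  WFMₚ P = T∞ P ∪not (λ L → L ∈ ℋ P ∖ Γ (P ˢ) (T∞ P))

  Γ-antitone : ∀ {i j} P {I : Pred (ObjLit Atom) i} {J : Pred (ObjLit Atom) j} →
               I ⊆ J → Γ P J ⊆ Γ P I
  Γ-antitone P I⊆J = LeastModel-least _
    λ { (r , r∈P , ns , refl) → derive (r , r∈P , All.map (λ n x → n (I⊆J x)) ns , refl) }

  ΓΓₛ-monotone : ∀ {i j} P {I : Pred (ObjLit Atom) i} {J : Pred (ObjLit Atom) j} →
                 I ⊆ J → ΓΓₛ P I ⊆ ΓΓₛ P J
  ΓΓₛ-monotone P I⊆J = Γ-antitone P (Γ-antitone (P ˢ) I⊆J)

  T∞-least : ∀ P (S : Pred (ObjLit Atom) ℓ) → ΓΓₛ P S ≐ S → T∞ P ⊆ S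
  T∞-least P S (pre , _) t = t S pre

  -- Excluded middle makes T∞ P equivalent to a predicate T at level ℓ, to
  -- which the usual Knaster–Tarski argument applies.
  T∞-fixpoint : ExcludedMiddle (suc ℓ) → ∀ P → ΓΓₛ P (T∞ P) ≐ T∞ P
  T∞-fixpoint em P = pre , λ t → ΓΓₛ-monotone P shrink⁻¹ (t (ΓΓₛ P T) post)
    where
    T : Pred (ObjLit Atom) ℓ
    T L = Lift ℓ (True (em {P = T∞ P L}))

    shrink : T∞ P ⊆ T
    shrink t = lift (fromWitness t)

    shrink⁻¹ : T ⊆ T∞ P
    shrink⁻¹ t = toWitness (lower t)

    pre : ΓΓₛ P (T∞ P) ⊆ T∞ P
    pre x S S-pre = S-pre (ΓΓₛ-monotone P (λ t → t S S-pre) x)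

    post : ΓΓₛ P (ΓΓₛ P T) ⊆ ΓΓₛ P T
    post = ΓΓₛ-monotone P (λ x → shrink (pre (ΓΓₛ-monotone P shrink⁻¹ x)))

{-# OPTIONS --safe #-}

-- A derivation in the reduct of P by I flattens to an argument whose rules all
-- survive the reduct, and conversely; by finiteness the argument can be made
-- minimal.  Taking I to be the conclusions of a set S of arguments, Γ P I are
-- the conclusions of the arguments not undercut by S.  The guard  not ∼ L  of
-- a semi-normal rule fails exactly when the rule is rebutted, so Γ (P ˢ) I are
-- the conclusions of the arguments not attacked by S.  Hence ΓΓₛ P I are the
-- conclusions of the arguments acceptable with respect to S, and the two least
-- fixpoints correspond.
module Submission where

open import Defs
open import Axiom.ExcludedMiddle using (ExcludedMiddle)
open import Level using (Level; suc)
open import Relation.Unary using (_≐_)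

open import Data.Fin using (zero) renaming (suc to sucᶠ)
open import Data.List using (List; []; _∷_; _++_; map; length)
open import Data.List.Membership.Propositional using (find; lose) renaming (_∈_ to _∈ₗ_)
open import Data.List.Membership.Propositional.Properties
  using (∈-map⁺; ∈-map⁻; ∈-++⁺ˡ; ∈-++⁺ʳ; ∈-concatMap⁺; ∈-concatMap⁻; ∈-lookup)
open import Data.List.Properties using (map-++)
open import Data.List.Relation.Binary.Pointwise using (Pointwise-≡⇒≡)
open import Data.List.Relation.Binary.Sublist.Heterogeneous.Properties using (toPointwise)
open import Data.List.Relation.Binary.Sublist.Propositional
  using (⊆-refl; ⊆-trans) renaming (_⊆_ to Subsequence)
open import Data.List.Relation.Binary.Sublist.Propositional.Properties
  using (All-resp-⊆; length-mono-≤)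
open import Data.List.Relation.Unary.All as All using (All; []; _∷_)
import Data.List.Relation.Unary.All.Properties as All
open import Data.List.Relation.Unary.Any using (here; there; index)
open import Data.List.Relation.Unary.Any.Properties using (lookup-index)
open import Data.Nat using (_<_; z≤n; s≤s; s<s⁻¹)
open import Data.Nat.Induction using (<-wellFounded)
open import Data.Nat.Properties using (≤∧≢⇒<)
open import Data.Product using (∃; _×_; _,_; proj₁; proj₂)
open import Data.Sum using (inj₁; inj₂)
open import Function using (_∘_)
open import Induction.WellFounded using (Acc; acc)
open import Level using (lift; lower)
open import Relation.Binary.PropositionalEquality using (_≡_; _≢_; refl; sym; trans; cong; subst)
open import Relation.Nullary using (¬_; yes; no)
open import Relation.Nullary.Decidable using (map′; decidable-stable)
open import Relation.Unary using (Pred; _∈_; _∉_; _⊆_; ∁)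

open Rule

private variable
  ℓ : Level

lower-em : ExcludedMiddle (suc ℓ) → ExcludedMiddle ℓ
lower-em em = map′ lower lift em

sublist-shorter : {A : Set ℓ} {xs ys : List A} →
                  Subsequence xs ys → xs ≢ ys → length xs < length ys
sublist-shorter τ xs≢ys =
  ≤∧≢⇒< (length-mono-≤ τ) λ eq → xs≢ys (Pointwise-≡⇒≡ (toPointwise eq τ))

module _ {Atom : Set ℓ} (P : Program Atom) where

  -- Support is sought only to the right, so prepending a rule leaves the support of the others
  -- intact. With `tail-argument` and `head-supported`, this turns the positional closure condition
  -- into a recursive one.
  ∷-argument : ∀ {r rs} → r ∈ P → All (_∈ₗ conc rs) (pos r) →
               IsArgument P rs → IsArgument P (r ∷ rs)
  ∷-argument {r} {rs} r∈P supported (rs⊆P , closed) = r∈P ∷ rs⊆P , λ where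
    zero L L∈pos →
      let r′ , r′∈rs , L≡ = ∈-map⁻ head (All.lookup supported L∈pos)
      in sucᶠ (index r′∈rs) , s≤s z≤n ,
         trans (cong head (sym (lookup-index r′∈rs))) (sym L≡)
    (sucᶠ i) L L∈pos →
      let k , i<k , eq = closed i L L∈pos in sucᶠ k , s≤s i<k , eq

  tail-argument : ∀ {r rs} → IsArgument P (r ∷ rs) → IsArgument P rs
  tail-argument (_ ∷ rs⊆P , closed) = rs⊆P , closed′
    where
    closed′ : _
    closed′ i L L∈pos with closed (sucᶠ i) L L∈pos
    ... | sucᶠ k , i<k , eq = k , s<s⁻¹ i<k , eq

  head-supported : ∀ {r rs} → IsArgument P (r ∷ rs) → All (_∈ₗ conc rs) (pos r)
  head-supported {r} {rs} (_ , closed) = All.tabulate support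
    where
    support : ∀ {L} → L ∈ₗ pos r → L ∈ₗ conc rs
    support L∈pos with closed zero _ L∈pos
    ... | sucᶠ k , _ , refl = ∈-map⁺ head (∈-lookup k)

  conc-++⁺ˡ : ∀ {L} {rs rs′ : List (Rule Atom)} → L ∈ₗ conc rs → L ∈ₗ conc (rs ++ rs′)
  conc-++⁺ˡ {rs = rs} {rs′} L∈ = subst (_ ∈ₗ_) (sym (map-++ head rs rs′)) (∈-++⁺ˡ L∈)

  conc-++⁺ʳ : ∀ {L} (rs : List (Rule Atom)) {rs′} → L ∈ₗ conc rs′ → L ∈ₗ conc (rs ++ rs′)
  conc-++⁺ʳ rs {rs′} L∈ = subst (_ ∈ₗ_) (sym (map-++ head rs rs′)) (∈-++⁺ʳ (conc rs) L∈)

  ++-argument : ∀ {rs rs′} → IsArgument P rs → IsArgument P rs′ → IsArgument P (rs ++ rs′)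
  ++-argument {[]}     _                     arg′ = arg′
  ++-argument {_ ∷ rs} arg@(r∈P ∷ _ , _) arg′ =
    ∷-argument r∈P (All.map (conc-++⁺ˡ {rs = rs}) (head-supported arg))
      (++-argument (tail-argument arg) arg′)

  -- Descent on length: `em` decides whether a proper subargument still concludes `L`, and any such
  -- subargument is strictly shorter.
  minimal-subargument : ExcludedMiddle ℓ → ∀ {L rs} → IsArgument P rs → L ∈ₗ conc rs →
    ∃ λ rs′ → Subargument P rs′ rs × MinimalFor P L rs′
  minimal-subargument em {L} arg L∈ = shrink (<-wellFounded _) arg L∈
    where
    shrink : ∀ {rs} → Acc _<_ (length rs) → IsArgument P rs → L ∈ₗ conc rs →
             ∃ λ rs′ → Subargument P rs′ rs × MinimalFor P L rs′
    shrink {rs} (acc rec) arg L∈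
      with em {P = ∃ λ rs′ → Subargument P rs′ rs × rs′ ≢ rs × L ∈ₗ conc rs′}
    ... | no ¬smaller =
      rs , (⊆-refl , arg) , L∈ , λ rs′ sub rs′≢ L∈′ → ¬smaller (rs′ , sub , rs′≢ , L∈′)
    ... | yes (rs′ , (τ , arg′) , rs′≢ , L∈′) =
      let rs″ , (τ′ , arg″) , min = shrink (rec (sublist-shorter τ rs′≢)) arg′ L∈′
      in rs″ , (⊆-trans τ′ τ , arg″) , min

  conc⊆ℋ : ∀ {L} (a : Args P) → ArgumentFor P L a → L ∈ ℋ P
  conc⊆ℋ (rs , (rs⊆P , _) , _) L∈ with ∈-map⁻ head L∈
  ... | r , r∈rs , refl = r , All.lookup rs⊆P r∈rs , here refl

  Conclusions : Pred (Args P) ℓ → Pred (ObjLit Atom) ℓ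
  Conclusions S L = ∃ λ a → ArgumentFor P L a × a ∈ S

  Conclusions-mono : ∀ {S S′} → S ⊆ S′ → Conclusions S ⊆ Conclusions S′
  Conclusions-mono S⊆S′ (a , L∈ , a∈S) = a , L∈ , S⊆S′ a∈S

  -- With E r = All (_∉ I) (neg r) this is reduct P I.
  selection : Pred (Rule Atom) ℓ → Pred (DefiniteRule (ObjLit Atom)) ℓ
  selection E d = ∃ λ r → r ∈ P × E r × d ≡ definite (head r) (pos r)

  module _ (E : Pred (Rule Atom) ℓ) where

    private
      -- Minimality is left out because concatenation need not preserve it, and `joint` concatenates
      -- the arguments for the body literals.
      Derivable : Pred (ObjLit Atom) ℓ
      Derivable L = ∃ λ rs → IsArgument P rs × All E rs × L ∈ₗ conc rs

      joint : ∀ {Ls} → All Derivable Ls →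
              ∃ λ rs → IsArgument P rs × All E rs × All (_∈ₗ conc rs) Ls
      joint [] = [] , ([] , λ ()) , [] , []
      joint ((rs , arg , es , L∈) ∷ ds) =
        let rs′ , arg′ , es′ , Ls⊆ = joint ds
        in rs ++ rs′ , ++-argument arg arg′ , All.++⁺ es es′ ,
           conc-++⁺ˡ {rs = rs} L∈ ∷ All.map (conc-++⁺ʳ rs) Ls⊆

      derivable-model : IsModel (selection E) Derivable
      derivable-model (r , r∈P , e , refl) ds =
        let rs , arg , es , supported = joint ds
        in r ∷ rs , ∷-argument r∈P supported arg , e ∷ es , here refl

      -- Induction from the right end: the body of the first rule is supported by heads in the tail,
      -- which are already derived.
      conc-derived : ∀ rs → IsArgument P rs → All E rs → All (LeastModel (selection E)) (conc rs)
      conc-derived []       _                  _        = []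
      conc-derived (r ∷ rs) arg@(r∈P ∷ _ , _) (e ∷ es) =
        derive (r , r∈P , e , refl) (All.map (All.lookup derived) (head-supported arg)) ∷ derived
        where derived = conc-derived rs (tail-argument arg) es

    LeastModel-selection : ExcludedMiddle ℓ →
      LeastModel (selection E) ≐ Conclusions (λ a → All E (proj₁ a))
    LeastModel-selection em = to , from
      where
      to : LeastModel (selection E) ⊆ Conclusions (λ a → All E (proj₁ a))
      to d =
        let rs , arg , es , L∈ = LeastModel-least (selection E) derivable-model d
            -- Minimality is restored only here; `All E` survives because it passes to sublists.
            rs′ , (τ , arg′) , min = minimal-subargument em arg L∈
        in (rs′ , arg′ , _ , min) , proj₁ min , All-resp-⊆ τ es

      from : Conclusions (λ a → All E (proj₁ a)) ⊆ LeastModel (selection E)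
      from ((rs , arg , _) , L∈ , es) = All.lookup (conc-derived rs arg es) L∈

  -- A common form of both relations: `targets = neg` gives undercutting, and `neg ∘ seminormal`
  -- gives attacking, the added literal `∼ head r` being what a rebuttal of `r` concludes.
  Hit : (Rule Atom → List (ObjLit Atom)) → Args P → Args P → Set ℓ
  Hit targets c a = ∃ λ r → r ∈ₗ proj₁ a × ∃ λ L → L ∈ₗ targets r × ArgumentFor P L c

  undercut⇒hit : ∀ {c a} → Undercuts P c a → Hit neg c a
  undercut⇒hit {a = a} (L , L∈c , L∈assm)
    with find (∈-concatMap⁻ (λ r → map not (neg r)) {xs = proj₁ a} L∈assm)
  ... | r , r∈a , L∈ with ∈-map⁻ not L∈
  ... | _ , L∈neg , refl = r , r∈a , L , L∈neg , L∈c

  hit⇒undercut : ∀ {c a} → Hit neg c a → Undercuts P c a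
  hit⇒undercut (r , r∈a , L , L∈neg , L∈c) =
    L , L∈c , ∈-concatMap⁺ (λ r → map not (neg r)) (lose r∈a (∈-map⁺ not L∈neg))

  attack⇒hit : ∀ {c a} → Attacks P c a → Hit (neg ∘ seminormal) c a
  attack⇒hit {c} {a} (inj₁ u) =
    let r , r∈a , L , L∈neg , L∈c = undercut⇒hit {c} {a} u in r , r∈a , L , there L∈neg , L∈c
  attack⇒hit (inj₂ (L , L∈c , ∼L∈a)) =
    let r , r∈a , ∼L≡ = ∈-map⁻ head ∼L∈a
    -- Here `∼ L` is `head r`, so the guard literal `∼ head r` is `L` itself by involution.
    in r , r∈a , L , here (trans (sym (∼-involutive L)) (cong ∼_ ∼L≡)) , L∈c

  hit⇒attack : ∀ {c a} → Hit (neg ∘ seminormal) c a → Attacks P c a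
  hit⇒attack (r , r∈a , _ , here refl , L∈c) =
    inj₂ (_ , L∈c , subst (_∈ₗ _) (sym (∼-involutive (head r))) (∈-map⁺ head r∈a))
  hit⇒attack {c} {a} (r , r∈a , L , there L∈neg , L∈c) =
    inj₁ (hit⇒undercut {c} {a} (r , r∈a , L , L∈neg , L∈c))

  Unhit : (Rule Atom → List (ObjLit Atom)) → Pred (Args P) ℓ → Pred (Args P) ℓ
  Unhit targets S a = ∀ c → c ∈ S → ¬ Hit targets c a

  -- Only quantifiers are exchanged: a target lies in `Conclusions S` exactly when some member of
  -- `S` hits through it.
  LeastModel-unhit : ExcludedMiddle ℓ → ∀ targets S →
    LeastModel (selection (λ r → All (_∉ Conclusions S) (targets r))) ≐
    Conclusions (Unhit targets S)
  LeastModel-unhit em targets S = Conclusions-mono (λ {a} → to {a}) ∘ proj₁ eq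
                                , proj₂ eq ∘ Conclusions-mono (λ {a} → from {a})
    where
    eq = LeastModel-selection (λ r → All (_∉ Conclusions S) (targets r)) em

    to : ∀ {a} → All (λ r → All (_∉ Conclusions S) (targets r)) (proj₁ a) → Unhit targets S a
    to es c c∈S (r , r∈a , L , L∈ , L∈c) =
      All.lookup (All.lookup es r∈a) L∈ (c , L∈c , c∈S)

    from : ∀ {a} → Unhit targets S a → All (λ r → All (_∉ Conclusions S) (targets r)) (proj₁ a)
    from unhit = All.tabulate λ r∈a → All.tabulate λ L∈ (c , L∈c , c∈S) →
      unhit c c∈S (_ , r∈a , _ , L∈ , L∈c)

  AttackedBy : Pred (Args P) ℓ → Pred (Args P) ℓ
  AttackedBy S a = ∃ λ c → c ∈ S × Attacks P c a

  -- `seminormal` changes neither head nor positive body, so both sides have the same definite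
  -- rules; only the survival test differs.
  seminormal-reduct : ∀ (I : Pred (ObjLit Atom) ℓ) →
    Γ (P ˢ) I ≐ LeastModel (selection (λ r → All (_∉ I) (neg (seminormal r))))
  seminormal-reduct I =
    LeastModel-least _ (λ { (_ , (r , r∈P , refl) , es , refl) → derive (r , r∈P , es , refl) }) ,
    LeastModel-least _ (λ { (r , r∈P , es , refl) →
      derive (seminormal r , (r , r∈P , refl) , es , refl) })

  Γₛ-Conclusions : ExcludedMiddle ℓ → ∀ S →
    Γ (P ˢ) (Conclusions S) ≐ Conclusions (∁ (AttackedBy S))
  Γₛ-Conclusions em S =
    Conclusions-mono (λ {a} unhit (c , c∈S , att) → unhit c c∈S (attack⇒hit {c} {a} att))
      ∘ proj₁ unhit≐ ∘ proj₁ (seminormal-reduct (Conclusions S)) ,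
    proj₂ (seminormal-reduct (Conclusions S)) ∘ proj₂ unhit≐ ∘
      Conclusions-mono (λ {a} unatt c c∈S hit → unatt (c , c∈S , hit⇒attack {c} {a} hit))
    where unhit≐ = LeastModel-unhit em (neg ∘ seminormal) S

  -- The inner operator leaves the arguments that `S` does not attack, and the outer one excludes
  -- whatever these undercut. So every undercutter of a remaining argument is attacked by `S`.
  ΓΓₛ-Conclusions : ExcludedMiddle ℓ → ∀ S →
    ΓΓₛ P (Conclusions S) ≐ Conclusions (Acceptable P S)
  ΓΓₛ-Conclusions em S =
    Conclusions-mono (λ {a} unhit b u →
        -- Being unhit by the unattacked arguments yields only a doubly negated counterattack on
        -- `b`.
        decidable-stable em (λ unatt → unhit b unatt (undercut⇒hit {b} {a} u)))
      ∘ proj₁ unhit≐ ∘ Γ-antitone P (proj₂ (Γₛ-Conclusions em S)) ,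
    Γ-antitone P (proj₁ (Γₛ-Conclusions em S)) ∘ proj₂ unhit≐ ∘
      Conclusions-mono (λ {a} acceptable b unatt hit →
        unatt (acceptable b (hit⇒undercut {b} {a} hit)))
    where unhit≐ = LeastModel-unhit em neg (∁ (AttackedBy S))

  T∞-justified : ExcludedMiddle ℓ → T∞ P ≐ Conclusions (Justified P)
  T∞-justified em =
    -- The conclusions of justified arguments form a pre-fixpoint at level `ℓ`, hence one of the
    -- sets that `T∞ P` intersects.
    (λ t → t _ (Conclusions-mono (proj₁ (Justified-fixpoint P))
                  ∘ proj₁ (ΓΓₛ-Conclusions em (Justified P)))) ,
    λ { (a , L∈ , j) S pre → Justified-least P (Within S) (λ {a} → within-pre S pre {a}) j _ L∈ }
    where
    -- Right adjoint to `Conclusions`: `Conclusions A ⊆ S` iff `A ⊆ Within S`. It carries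
    -- pre-fixpoints of `ΓΓₛ P` to pre-fixpoints of `Acceptable P`, so that leastness of
    -- `Justified P` applies.
    Within : Pred (ObjLit Atom) ℓ → Pred (Args P) ℓ
    Within S a = ∀ L → ArgumentFor P L a → L ∈ S

    within-pre : ∀ S → ΓΓₛ P S ⊆ S → Acceptable P (Within S) ⊆ Within S
    within-pre S pre {a} acceptable _ L∈ =
      pre (ΓΓₛ-monotone P (λ { (_ , L∈b , b⊆S) → b⊆S _ L∈b })
        (proj₂ (ΓΓₛ-Conclusions em (Within S)) (a , L∈ , acceptable)))

theorem11 : ∀ {ℓ : Level} → ExcludedMiddle (suc ℓ) →
    ∀ {Atom : Set ℓ} (P : Program Atom) → WFMₚ P ≐ 𝒜 P
theorem11 {ℓ} em⁺ P = (λ {l} → to l) , (λ {l} → from l)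
  where
  em : ExcludedMiddle ℓ
  em = lower-em em⁺

  T≐ = T∞-justified P em
  Γₛ≐ = Γₛ-Conclusions P em (Justified P)

  to : ∀ l → l ∈ WFMₚ P → l ∈ 𝒜 P
  to (obj L) t = let a , L∈ , j = proj₁ T≐ t in conc⊆ℋ P a L∈ , a , L∈ , j
  -- `Overruled P` unfolds to `AttackedBy` applied to `Justified P`, so an argument for `L` that is
  -- not overruled would put `L` into `Γ (P ˢ) (T∞ P)`.
  to (not L) (L∈ℋ , L∉Γₛ) = L∈ℋ , λ a L∈ → decidable-stable em λ unatt →
    L∉Γₛ (Γ-antitone (P ˢ) (proj₁ T≐) (proj₂ Γₛ≐ (a , L∈ , unatt)))

  from : ∀ l → l ∈ 𝒜 P → l ∈ WFMₚ P
  from (obj L) (_ , c) = proj₂ T≐ c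
  from (not L) (L∈ℋ , overruled) = L∈ℋ , λ L∈Γₛ →
    let a , L∈ , unatt = proj₁ Γₛ≐ (Γ-antitone (P ˢ) (proj₂ T≐) L∈Γₛ)
    in unatt (overruled a L∈)
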